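{- The relation $\to_{\mathscr{O}}$ is strongly normalizing: there is no infinite sequence of configurations $C_1\to_{\mathscr{O}}C_2\to_{\mathscr{O}}C_3\to_{\mathscr{O}}\cdots$.
   Context: The Q-calculus. Terms: classical variables $x$; quantum variables $r$; patterns $\pi::=x\mid\langle x_1,\dots,x_n\rangle$; constants $0,1$ and unitary symbols $U_i$; terms $M::=x\mid r\mid\ !M\mid C\mid \mathtt{new}(M)\mid (M_1)M_2\mid\langle M_1,\dots,M_n\rangle\ (n\ge2)\mid \lambda!x.M\mid\lambda\pi.M$ modulo $\alpha$-conversion. A configuration is (an equivalence class modulo renaming of quantum variables of) a triple $[\mathcal{Q},\mathcal{QV},M]$ where $\mathcal{QV}$ is a finite set of quantum variables containing those of $M$ and $\mathcal{Q}$ is a vector in the Hilbert space of functions $\{0,1\}^{\mathcal{QV}}\to\mathbb{C}$; configurations considered are well formed (the term is derivable in the calculus's linear well-forming system). The commutative reductions are ($\mathsf{l.cm}$) $[\mathcal{Q},\mathcal{QV},L((\lambda\pi.M)N)]\to[\mathcal{Q},\mathcal{QV},(\lambda\pi.LM)N]$ and ($\mathsf{r.cm}$) $[\mathcal{Q},\mathcal{QV},((\lambda\pi.M)N)L]\to[\mathcal{Q},\mathcal{QV},(\lambda\pi.ML)N]$, closed under the contexts: a component of a tuple $\langle\dots\rangle$, either side of an application, and the body of $\lambda\pi.(\cdot)$ (not inside $!M$). $\mathscr{O}=\{\mathsf{l.cm},\mathsf{r.cm}\}$ and $\to_{\mathscr{O}}$ is the union of these two reductions. -}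

module Defs where

open import Data.Nat using (ℕ; zero; suc; _+_; _<ᵇ_)
open import Data.Bool using (Bool; if_then_else_)
open import Data.List using (List; []; _∷_)
open import Data.List.Membership.Propositional using (_∈_)

-- Syntax of the Q-calculus (classical variables as de Bruijn indices,
-- so α-conversion is built in; quantum variables are names r ∈ ℕ).

data Const : Set where
  c0 c1 : Const
  U     : ℕ → Const

-- Patterns π ::= x | ⟨x₁,…,xₙ⟩.  'ptup k' is a tuple pattern of arity 2+k.
data Pat : Set where
  pvar : Pat
  ptup : ℕ → Pat

binds : Pat → ℕ
binds pvar     = 1
binds (ptup k) = 2 + k

-- Terms.  'tup M₁ M₂ Ms' is the tuple ⟨M₁,M₂,Ms…⟩ (arity ≥ 2).
data Term : Set where
  var   : ℕ → Term
  qvar  : ℕ → Term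
  bang  : Term → Term
  const : Const → Term
  new   : Term → Term
  app   : Term → Term → Term
  tup   : Term → Term → List Term → Term
  lam!  : Term → Term
  lamP  : Pat → Term → Term

mutual
  shift : ℕ → ℕ → Term → Term
  shift c d (var n)      = if n <ᵇ c then var n else var (n + d)
  shift c d (qvar r)     = qvar r
  shift c d (bang M)     = bang (shift c d M)
  shift c d (const k)    = const k
  shift c d (new M)      = new (shift c d M)
  shift c d (app M N)    = app (shift c d M) (shift c d N)
  shift c d (tup M N Ms) = tup (shift c d M) (shift c d N) (shiftList c d Ms)
  shift c d (lam! M)     = lam! (shift (suc c) d M)
  shift c d (lamP π M)   = lamP π (shift (binds π + c) d M)

  shiftList : ℕ → ℕ → List Term → List Term
  shiftList c d []       = []
  shiftList c d (M ∷ Ms) = shift c d M ∷ shiftList c d Ms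

wk : Pat → Term → Term
wk π = shift 0 (binds π)

-- Commutative reductions l.cm and r.cm, closed under the contexts:
-- tuple components, either side of an application, body of λπ.(·)
-- (not under !, new, λ!x).

mutual
  data _⇒O_ : Term → Term → Set where
    l-cm : ∀ {L π M N} →
           app L (app (lamP π M) N) ⇒O app (lamP π (app (wk π L) M)) N
    r-cm : ∀ {L π M N} →
           app (app (lamP π M) N) L ⇒O app (lamP π (app M (wk π L))) N
    appˡ : ∀ {M M′ N} → M ⇒O M′ → app M N ⇒O app M′ N
    appʳ : ∀ {M N N′} → N ⇒O N′ → app M N ⇒O app M N′
    lamPᶜ : ∀ {π M M′} → M ⇒O M′ → lamP π M ⇒O lamP π M′
    tup₁ : ∀ {M M′ N Ms} → M ⇒O M′ → tup M N Ms ⇒O tup M′ N Ms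
    tup₂ : ∀ {M N N′ Ms} → N ⇒O N′ → tup M N Ms ⇒O tup M N′ Ms
    tupₙ : ∀ {M N Ms Ms′} → Ms ⇒Oˡ Ms′ → tup M N Ms ⇒O tup M N Ms′

  data _⇒Oˡ_ : List Term → List Term → Set where
    here  : ∀ {M M′ Ms} → M ⇒O M′ → (M ∷ Ms) ⇒Oˡ (M′ ∷ Ms)
    there : ∀ {M Ms Ms′} → Ms ⇒Oˡ Ms′ → (M ∷ Ms) ⇒Oˡ (M ∷ Ms′)

-- QV is a finite set of quantum variables
-- (a list of names), Q a function {0,1}^QV → ℂ.  The scalar field ℂ is
-- kept abstract (not available in agda-stdlib); reductions never inspect it.

record Config (ℂ : Set) : Set where
  constructor ⟨_,_,_⟩
  field
    QV   : List ℕ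
    Q    : ((r : ℕ) → r ∈ QV → Bool) → ℂ
    term : Term

data _⟶O_ {ℂ : Set} : Config ℂ → Config ℂ → Set where
  step : ∀ {QV Q M M′} → M ⇒O M′ → ⟨ QV , Q , M ⟩ ⟶O ⟨ QV , Q , M′ ⟩

{-# OPTIONS --safe #-}
-- Weigh a term by reading application as multiplication, tupling as addition,
-- λπ.M as 1 + M and every other term (including !M, new(M), λ!x.M, under which
-- no step happens) as 2.  An l.cm step turns the weight L · (1 + M) · N into
-- (1 + L · M) · N, and r.cm turns (1 + M) · N · L into (1 + M · L) · N; both
-- are strictly smaller since L ≥ 2 and N > 0.  Weakening preserves weights and
-- the weight is strictly monotone in every position where a step may occur, so
-- each O-step makes the weight drop in ℕ.
module Submission where

open import Defs
open import Data.Bool using (true; false)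
open import Data.List using (List; []; _∷_)
open import Data.Nat using (ℕ; suc; s≤s; _+_; _*_; _≤_; _<_; _<ᵇ_; NonZero; >-nonZero)
open import Data.Nat.Induction using (<-wellFounded)
open import Data.Nat.Properties
open import Algebra.Properties.CommutativeSemigroup *-commutativeSemigroup using (xy∙z≈xz∙y)
open import Function using (flip)
open import Induction.WellFounded using (WellFounded; Acc; acc; module Subrelation)
open import Level using (Level)
open import Relation.Binary.Core using (Rel)
open import Relation.Binary.Construct.On as On using ()
open import Relation.Binary.PropositionalEquality using (_≡_; refl; cong; cong₂)
open import Relation.Nullary using (¬_)

module _ {a ℓ : Level} {A : Set a} {_<_ : Rel A ℓ} where

  acc⇒¬descending : (f : ℕ → A) {i : ℕ} → Acc _<_ (f i) → ¬ (∀ j → f (suc j) < f j)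
  acc⇒¬descending f {i} (acc rs) descending = acc⇒¬descending f (rs (descending i)) descending

  wf⇒¬descending : WellFounded _<_ → (f : ℕ → A) → ¬ (∀ i → f (suc i) < f i)
  wf⇒¬descending wf f = acc⇒¬descending f (wf (f 0))

1+m*n<[1+m]*n : ∀ m {n} → 2 ≤ n → suc (m * n) < suc m * n
1+m*n<[1+m]*n m {n} = +-monoˡ-< (m * n)

mutual
  weight : Term → ℕ
  weight (app M N)    = weight M * weight N
  weight (tup M N Ms) = weight M + weight N + weights Ms
  weight (lamP π M)   = suc (weight M)
  weight _            = 2

  weights : List Term → ℕ
  weights []       = 0
  weights (M ∷ Ms) = weight M + weights Ms

mutual
  2≤weight : ∀ M → 2 ≤ weight M
  2≤weight (var _)      = ≤-refl
  2≤weight (qvar _)     = ≤-refl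
  2≤weight (bang _)     = ≤-refl
  2≤weight (const _)    = ≤-refl
  2≤weight (new _)      = ≤-refl
  2≤weight (app M N)    = ≤-trans (2≤weight M) (m≤m*n (weight M) (weight N) {{weight-nonZero N}})
  2≤weight (tup M N Ms) = ≤-trans (2≤weight M) (≤-trans (m≤m+n _ _) (m≤m+n _ _))
  2≤weight (lam! _)     = ≤-refl
  2≤weight (lamP π M)   = m≤n⇒m≤1+n (2≤weight M)

  weight-nonZero : ∀ M → NonZero (weight M)
  weight-nonZero M = >-nonZero (≤-trans (n≤1+n 1) (2≤weight M))

mutual
  weight-shift : ∀ c d M → weight (shift c d M) ≡ weight M
  weight-shift c d (var n) with n <ᵇ c
  ... | true  = refl
  ... | false = refl
  weight-shift c d (qvar _)     = refl
  weight-shift c d (bang _)     = refl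
  weight-shift c d (const _)    = refl
  weight-shift c d (new _)      = refl
  weight-shift c d (app M N)    = cong₂ _*_ (weight-shift c d M) (weight-shift c d N)
  weight-shift c d (tup M N Ms) =
    cong₂ _+_ (cong₂ _+_ (weight-shift c d M) (weight-shift c d N)) (weights-shiftList c d Ms)
  weight-shift c d (lam! _)     = refl
  weight-shift c d (lamP π M)   = cong suc (weight-shift (binds π + c) d M)

  weights-shiftList : ∀ c d Ms → weights (shiftList c d Ms) ≡ weights Ms
  weights-shiftList c d []       = refl
  weights-shiftList c d (M ∷ Ms) = cong₂ _+_ (weight-shift c d M) (weights-shiftList c d Ms)

weight-wk : ∀ π M → weight (wk π M) ≡ weight M
weight-wk π = weight-shift 0 (binds π)

mutual
  ⇒O-weight-< : ∀ {M M′} → M ⇒O M′ → weight M′ < weight M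
  ⇒O-weight-< (l-cm {L} {π} {M} {N}) = begin-strict
    suc (weight (wk π L) * weight M) * weight N  ≡⟨ cong (λ l → suc (l * weight M) * weight N) (weight-wk π L) ⟩
    suc (weight L * weight M) * weight N         ≡⟨ cong (λ k → suc k * weight N) (*-comm (weight L) (weight M)) ⟩
    suc (weight M * weight L) * weight N         <⟨ *-monoˡ-< (weight N) {{weight-nonZero N}} (1+m*n<[1+m]*n (weight M) (2≤weight L)) ⟩
    suc (weight M) * weight L * weight N         ≡⟨ cong (_* weight N) (*-comm (suc (weight M)) (weight L)) ⟩
    weight L * suc (weight M) * weight N         ≡⟨ *-assoc (weight L) (suc (weight M)) (weight N) ⟩
    weight L * (suc (weight M) * weight N)       ∎
    where open ≤-Reasoning
  ⇒O-weight-< (r-cm {L} {π} {M} {N}) = begin-strict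
    suc (weight M * weight (wk π L)) * weight N  ≡⟨ cong (λ l → suc (weight M * l) * weight N) (weight-wk π L) ⟩
    suc (weight M * weight L) * weight N         <⟨ *-monoˡ-< (weight N) {{weight-nonZero N}} (1+m*n<[1+m]*n (weight M) (2≤weight L)) ⟩
    suc (weight M) * weight L * weight N         ≡⟨ xy∙z≈xz∙y (suc (weight M)) (weight L) (weight N) ⟩
    suc (weight M) * weight N * weight L         ∎
    where open ≤-Reasoning
  ⇒O-weight-< (appˡ {N = N} s)         = *-monoˡ-< (weight N) {{weight-nonZero N}} (⇒O-weight-< s)
  ⇒O-weight-< (appʳ {M} s)             = *-monoʳ-< (weight M) {{weight-nonZero M}} (⇒O-weight-< s)
  ⇒O-weight-< (lamPᶜ s)                = s≤s (⇒O-weight-< s)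
  ⇒O-weight-< (tup₁ {N = N} {Ms} s)    = +-monoˡ-< (weights Ms) (+-monoˡ-< (weight N) (⇒O-weight-< s))
  ⇒O-weight-< (tup₂ {M} {Ms = Ms} s)   = +-monoˡ-< (weights Ms) (+-monoʳ-< (weight M) (⇒O-weight-< s))
  ⇒O-weight-< (tupₙ {M} {N} s)         = +-monoʳ-< (weight M + weight N) (⇒Oˡ-weights-< s)

  ⇒Oˡ-weights-< : ∀ {Ms Ms′} → Ms ⇒Oˡ Ms′ → weights Ms′ < weights Ms
  ⇒Oˡ-weights-< (here {Ms = Ms} s) = +-monoˡ-< (weights Ms) (⇒O-weight-< s)
  ⇒Oˡ-weights-< (there {M} s)      = +-monoʳ-< (weight M) (⇒Oˡ-weights-< s)

⇒O-wellFounded : WellFounded (flip _⇒O_)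
⇒O-wellFounded = Subrelation.wellFounded ⇒O-weight-< (On.wellFounded weight <-wellFounded)

⟶O⇒⇒O : ∀ {ℂ} {C C′ : Config ℂ} → C ⟶O C′ → Config.term C ⇒O Config.term C′
⟶O⇒⇒O (step s) = s

⟶O-wellFounded : ∀ {ℂ} → WellFounded (flip (_⟶O_ {ℂ}))
⟶O-wellFounded = Subrelation.wellFounded ⟶O⇒⇒O (On.wellFounded Config.term ⇒O-wellFounded)

mainTheorem6 : {ℂ : Set} (C : ℕ → Config ℂ) →
    ¬ ((i : ℕ) → C i ⟶O C (suc i))
mainTheorem6 = wf⇒¬descending ⟶O-wellFounded
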